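{- Let $N\ge1$, $p_1,\dots,p_N\ge1$ and consider the $1$-triangulated polygon $\mathcal P(p_1,\dots,p_N)$. For an edge or diagonal $e$ of the triangulation write $x(e)$ for its initial cluster variable. Let $D^{[p_1,\dots,p_i]}$ ($1\le i\le N$) be the Laurent expansion of the cluster variable of the arc from $A$ to $W_{i,p_i+1}$ (so that $D^{[p_1,\dots,p_N]}$ is the variable of $\gamma=AB$), and put $D^{[\,]}:=x(e_0)$. Then: (I) If $N=1$, $$D^{[p_1]}=x(e_0)\,x(e_{p_1+1})\sum_{r=1}^{p_1+1}\frac{x(o_r)}{x(e_{r-1})\,x(e_r)} .$$ (II, III) If $N\ge2$, $$D^{[p_1,\dots,p_N]}=\frac{x(e_{P_N+1})}{x(e_{P_{N-1}+1})}\,D^{[p_1,\dots,p_{N-2}]}+x(e_{P_N+1})\left(\sum_{r=P_{N-1}+2}^{P_N+1}\frac{x(o_r)}{x(e_{r-1})\,x(e_r)}\right)D^{[p_1,\dots,p_{N-1}]} .$$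
   Context: **The triangulated polygon $\mathcal P(p_1,\dots,p_N)$.** Put $P_0=0$, $P_i=p_1+\dots+p_i$. The polygon is an $m$-gon with $m=3+P_N$, triangulated by triangles $\tau_1,\dots,\tau_{m-2}$ glued consecutively from a vertex $A$ to a vertex $B$, as follows. There are fan centres $C_1,\dots,C_N$ (write also $V:=C_N$) and vertices $W_{i,s}$ ($1\le i\le N$, $1\le s\le p_i+1$), with identifications $W_{i,1}=C_{i-1}$ for $i\ge2$, $W_{i,p_i+1}=C_{i+1}$ for $i<N$, and $W_{N,p_N+1}=B$. Otherwise the vertices $A,B,C_i,W_{i,s}$ are distinct, and they are all the vertices. The triangles are $\tau_1=AC_1W_{1,1}$ and $\tau_{P_{i-1}+1+s}=C_iW_{i,s}W_{i,s+1}$ for $1\le i\le N$, $1\le s\le p_i$. Consecutive triangles $\tau_r,\tau_{r+1}$ share the diagonal $e_r$ ($1\le r\le m-3$), where $e_{P_{i-1}+s}=C_iW_{i,s}$ for $1\le s\le p_i$. The diagonal $AB$ crosses exactly these diagonals, each once. Further put $e_0:=AC_1$ and $e_{P_N+1}:=VB$ (boundary edges). Let $o_r$ be the third edge of $\tau_r$, different from $e_{r-1}$ and $e_r$ (so $o_1=AW_{1,1}$ and $o_{P_{i-1}+1+s}=W_{i,s}W_{i,s+1}$). The triangles $\tau_1,\dots,\tau_{P_i+1}$ form a subpolygon of type $\mathcal P(p_1,\dots,p_i)$ whose endpoint "$B$" is $W_{i,p_i+1}$. **Cluster structure ($n=1$).** This is the usual cluster algebra of a polygon: one variable per edge/diagonal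 of the triangulation (boundary edges frozen). Flipping a diagonal $d$ of a quadrilateral with cyclically ordered sides $a,b,c,d'$ into the other diagonal $\bar d$ gives $x(\bar d)=\frac{x(a)x(c)+x(b)x(d')}{x(d)}$. The variable of any arc is obtained by a sequence of flips and is expressed in the initial variables. -}

module Defs where

open import Algebra.Apartness.Bundles using (HeytingCommutativeRing; HeytingField)
import Algebra.Apartness.Properties.HeytingCommutativeRing as HeytingProperties
open import Algebra.Bundles using (CommutativeRing)
open import Data.Fin.Base using (toℕ)
open import Data.Integer.Base as ℤ using (ℤ; _◃_)
open import Data.Nat.Base using (ℕ; zero; suc; _+_; _∸_; _≤_)
open import Data.Product.Base using (Σ-syntax; ∃-syntax; _×_; _,_; proj₁)
open import Data.Sign.Base using (Sign; opposite)
open import Data.Sum.Base using (_⊎_)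
open import Level using (_⊔_) renaming (suc to lsuc)
open import Relation.Binary.PropositionalEquality using (_≡_)
open import Relation.Nullary using (¬_)

module FieldNotation {c ℓ₁ ℓ₂} (F : HeytingField c ℓ₁ ℓ₂) where

  open HeytingField F
    using (_#_; 0#; #⇒invertible; heytingCommutativeRing)
  open HeytingField F public
    using (Carrier; _≈_) renaming (_+_ to _+ᶠ_; _*_ to _*ᶠ_)
  open HeytingProperties heytingCommutativeRing using (x#0y#0→xy#0)
  open HeytingCommutativeRing heytingCommutativeRing using (commutativeRing)
  open CommutativeRing commutativeRing using (+-commutativeMonoid)
  open import Algebra.Properties.CommutativeMonoid.Sum +-commutativeMonoid using (sum)

  Carrier* : Set (c ⊔ ℓ₂)
  Carrier* = Σ[ y ∈ Carrier ] y # 0#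

  infixl 7 _·_ _/_

  _·_ : Carrier* → Carrier* → Carrier*
  (y , y#0) · (z , z#0) = y *ᶠ z , x#0y#0→xy#0 y#0 z#0

  -- The library inverts y - 0# here, which is ≈ y.
  _/_ : Carrier → Carrier* → Carrier
  y / (z , z#0) = y *ᶠ proj₁ (#⇒invertible z#0)

  -- Both bounds are included; the sum is 0# if the upper bound is below the
  -- lower one.
  ∑[_⋯_] : ℕ → ℕ → (ℕ → Carrier) → Carrier
  ∑[ lo ⋯ hi ] f = sum {suc hi ∸ lo} (λ k → f (lo + toℕ k))

-- The vertices of a polygon are finitely many integers, and their cyclic order
-- around the polygon is the one induced by the order of ℤ.
CyclicallyOrdered : (a b c d : ℤ) → Set
CyclicallyOrdered a b c d =
  Chain a b c d ⊎ Chain b c d a ⊎ Chain c d a b ⊎ Chain d a b c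
  where
  Chain : (u v w z : ℤ) → Set
  Chain u v w z = u ℤ.< v × v ℤ.< w × w ℤ.< z

SameArc : (u v u′ v′ : ℤ) → Set
SameArc u v u′ v′ = (u ≡ u′ × v ≡ v′) ⊎ (u ≡ v′ × v ≡ u′)

module PolygonCluster {c ℓ₁ ℓ₂} (F : HeytingField c ℓ₁ ℓ₂) where

  open FieldNotation F

  -- A triangulation with its cluster: S u v y says that the edge or diagonal
  -- uv belongs to the triangulation and that its variable is y.
  Seed : Set (lsuc c)
  Seed = ℤ → ℤ → Carrier → Set c

  -- The seed S with the diagonal ac replaced by bd, whose variable is y.
  data Flipped (S : Seed) (a b c′ d : ℤ) (y : Carrier) : Seed where
    kept : ∀ {u v z} → S u v z → ¬ SameArc u v a c′ → Flipped S a b c′ d y u v z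
    new  : Flipped S a b c′ d y b d y
    new′ : Flipped S a b c′ d y d b y

  -- Boundary edges are frozen automatically: no quadrilateral inscribed in the
  -- polygon has one of them as a diagonal.
  data MutationClass (S₀ : Seed) : Seed → Set (lsuc c ⊔ ℓ₂) where
    initial : MutationClass S₀ S₀
    flip    : ∀ {S a b c′ d y₁ y₂ y₃ y₄} (y : Carrier*) →
              MutationClass S₀ S →
              CyclicallyOrdered a b c′ d →
              S a b y₁ → S b c′ y₂ → S c′ d y₃ → S d a y₄ →
              S a c′ (proj₁ y) →
              MutationClass S₀
                (Flipped S a b c′ d ((y₁ *ᶠ y₃ +ᶠ y₂ *ᶠ y₄) / y))

  IsClusterVariable : Seed → ℤ → ℤ → Carrier → Set (lsuc c ⊔ ℓ₁ ⊔ ℓ₂)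
  IsClusterVariable S₀ u v y =
    ∃[ S ] MutationClass S₀ S × ∃[ z ] S u v z × y ≈ z

-- p₁, …, p_N are the values p 1, …, p N; all indices are 1-based, and the
-- values of C, W at indices outside their range are irrelevant.
module Polygon (p : ℕ → ℕ) where

  P : ℕ → ℕ
  P zero    = 0
  P (suc i) = P i + p (suc i)

  A : ℤ
  A = ℤ.0ℤ

  -- The diagonal AB has C_i on one side and W_{i,1}, …, W_{i,p_i+1} on the other;
  -- side i is the side of the latter, and C₁ is on the positive side.
  side : ℕ → Sign
  side zero    = Sign.+
  side (suc i) = opposite (side i)

  -- The absolute value of a vertex is its rank in the order of gluing: A, C₁,
  -- W_{1,1} are 0, 1, 2, and the vertex that τ_r adds (r ≥ 2) is r + 1.  Away
  -- from A each side of AB is traversed in this order.  The vertex B has the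
  -- largest absolute value, so in the cyclic order it comes last on both sides,
  -- whatever its sign.
  C : ℕ → ℤ
  W : ℕ → ℕ → ℤ

  C zero          = ℤ.0ℤ
  C 1             = ℤ.1ℤ
  C (suc (suc i)) = W (suc i) (p (suc i) + 1)

  W zero          s = ℤ.0ℤ
  W (suc (suc i)) 1 = C (suc i)
  W (suc i)       s = side (suc i) ◃ (P i + s + 1)

  module Triangulation
    {c ℓ₁ ℓ₂} (F : HeytingField c ℓ₁ ℓ₂)
    (N : ℕ)
    (xe xo : ℕ → FieldNotation.Carrier* F)   -- r ↦ x(e_r) and r ↦ x(o_r)
    where

    open FieldNotation F
    open PolygonCluster F

    x[e_] x[o_] : ℕ → Carrier
    x[e r ] = proj₁ (xe r)
    x[o r ] = proj₁ (xo r)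

    B : ℤ
    B = W N (p N + 1)

    data InitialSeed : ℤ → ℤ → Carrier → Set c where
      e-first : InitialSeed A (C 1) x[e 0 ]
      e-inner : ∀ {i s} → suc i ≤ N → 1 ≤ s → s ≤ p (suc i) →
                InitialSeed (C (suc i)) (W (suc i) s) x[e P i + s ]
      e-last  : InitialSeed (C N) B x[e P N + 1 ]
      o-first : InitialSeed A (W 1 1) x[o 1 ]
      o-outer : ∀ {i s} → suc i ≤ N → 1 ≤ s → s ≤ p (suc i) →
                InitialSeed (W (suc i) s) (W (suc i) (s + 1))
                  x[o P i + 1 + s ]
      swap    : ∀ {u v y} → InitialSeed u v y → InitialSeed v u y

    -- y is a value of D^{[p₁,…,p_i]}, for i ≥ 1.
    IsD : ℕ → Carrier → Set (lsuc c ⊔ ℓ₁ ⊔ ℓ₂)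
    IsD i y = IsClusterVariable InitialSeed A (W i (p i + 1)) y

    term : ℕ → Carrier
    term r = x[o r ] / (xe (r ∸ 1) · xe r)

-- Attach to each vertex z of the polygon a vector φ z of F², such that the edges and
-- diagonals of the initial triangulation are measured by determinants.  The Plücker
-- relation is the exchange relation of every inscribed quadrilateral, so all cluster
-- variables are such determinants, whatever the sequence of flips.  Along a fan with
-- centre C, gluing the triangle with outer edge o to the diagonal e = C w, with next
-- diagonal e′ = C w′, gives w′ / e′ = w / e − o / (e e′) C.  Summing over the fan and
-- taking determinants with A yields the recurrence.  Flipping e_1, e_2, … in this order
-- reaches every D^{[p_1,…,p_i]}, dividing by initial variables only.
module Submission where

open import Defs
open import Algebra.Apartness.Bundles using (HeytingCommutativeRing; HeytingField)
import Algebra.Apartness.Properties.HeytingCommutativeRing as HeytingProperties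
open import Algebra.Bundles using (CommutativeRing)
import Algebra.Properties.CommutativeMonoid.Sum as Sum
import Algebra.Solver.Ring.NaturalCoefficients.Default as NaturalCoefficients
open import Data.Fin.Base using (toℕ)
open import Data.Integer.Base as ℤ using (ℤ; ∣_∣; _◃_; -<-; -<+; +<+)
import Data.Integer.Properties as ℤ
open import Data.Nat.Base using (ℕ; zero; suc; pred; _+_; _∸_; _≤_; _<_; z≤n; s≤s)
import Data.Nat.Properties as ℕ
open import Data.Product.Base using (∃-syntax; _×_; _,_; proj₁; proj₂) renaming (swap to ×-swap)
open import Data.Sign.Base using (Sign; opposite)
open import Data.Sign.Properties using (opposite-involutive)
open import Data.Sum.Base using (_⊎_; inj₁; inj₂; map)
open import Function.Base using (_∘_)
open import Level using (_⊔_) renaming (suc to lsuc)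
open import Relation.Binary.Definitions using (tri<; tri≈; tri>)
open import Relation.Binary.PropositionalEquality as ≡ using (_≡_; subst; cong)
import Relation.Binary.Reasoning.Setoid as SetoidReasoning
open import Relation.Nullary using (¬_; yes; no; contradiction)

-- Inverses, finite sums and planar determinants over a Heyting field.

module FieldProperties {c ℓ₁ ℓ₂} (F : HeytingField c ℓ₁ ℓ₂) where

  open FieldNotation F
  open HeytingField F using (#⇒invertible; heytingCommutativeRing)
  open HeytingProperties heytingCommutativeRing using (x-0≈x)

  commutativeRing : CommutativeRing c ℓ₁
  commutativeRing = HeytingCommutativeRing.commutativeRing heytingCommutativeRing

  open CommutativeRing commutativeRing public
    using (0#; 1#; -_; setoid; refl; sym; trans; reflexive;
           +-cong; +-congˡ; +-congʳ; *-cong; *-congˡ; *-congʳ;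
           +-identityʳ; *-identityʳ; *-identityˡ; zeroˡ; zeroʳ; *-comm; *-assoc)
  open CommutativeRing commutativeRing
    using (ring; commutativeSemiring; +-commutativeMonoid; -‿inverseʳ)
  open NaturalCoefficients commutativeSemiring public using (solve; _:=_; _:+_; _:*_; con)
  open Sum +-commutativeMonoid public using (sum; sum-cong-≋)
  open SetoidReasoning setoid

  infix 8 _⁻¹

  _⁻¹ : Carrier* → Carrier
  (_ , z#0) ⁻¹ = proj₁ (#⇒invertible z#0)

  ⁻¹-inverseʳ : ∀ z → proj₁ z *ᶠ z ⁻¹ ≈ 1#
  ⁻¹-inverseʳ (z , z#0) =
    trans (*-congʳ (sym (x-0≈x z))) (proj₂ (proj₂ (#⇒invertible z#0)))

  cancel : ∀ x z → x *ᶠ (proj₁ z *ᶠ z ⁻¹) ≈ x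
  cancel x z = trans (*-congˡ (⁻¹-inverseʳ z)) (*-identityʳ x)

  ·-⁻¹ : ∀ y z → (y · z) ⁻¹ ≈ y ⁻¹ *ᶠ z ⁻¹
  ·-⁻¹ y z = begin
    (y · z) ⁻¹                                                     ≈⟨ cancel _ y ⟨
    (y · z) ⁻¹ *ᶠ (proj₁ y *ᶠ y ⁻¹)                                 ≈⟨ cancel _ z ⟨
    (y · z) ⁻¹ *ᶠ (proj₁ y *ᶠ y ⁻¹) *ᶠ (proj₁ z *ᶠ z ⁻¹)
      ≈⟨ solve 5 (λ w y y′ z z′ → w :* (y :* y′) :* (z :* z′) := y′ :* z′ :* (y :* z :* w))
           refl ((y · z) ⁻¹) (proj₁ y) (y ⁻¹) (proj₁ z) (z ⁻¹) ⟩
    y ⁻¹ *ᶠ z ⁻¹ *ᶠ (proj₁ y *ᶠ proj₁ z *ᶠ (y · z) ⁻¹)              ≈⟨ cancel _ (y · z) ⟩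
    y ⁻¹ *ᶠ z ⁻¹                                                   ∎

  -- Made for a fan: `l` is constant because the centre stays fixed, while each glued triangle
  -- contributes one `t k`.
  telescope : ∀ (b t : ℕ → Carrier) l n → (∀ k → b (suc k) ≈ b k +ᶠ t k *ᶠ l) →
              b n ≈ b 0 +ᶠ sum {n} (t ∘ toℕ) *ᶠ l
  telescope b t l zero    _    =
    sym (trans (+-congˡ (zeroˡ l)) (+-identityʳ (b 0)))
  telescope b t l (suc n) step = begin
    b (suc n)
      ≈⟨ telescope (b ∘ suc) (t ∘ suc) l n (step ∘ suc) ⟩
    b 1 +ᶠ s *ᶠ l                 ≈⟨ +-congʳ (step 0) ⟩
    b 0 +ᶠ t 0 *ᶠ l +ᶠ s *ᶠ l
      ≈⟨ solve 4 (λ b t s l → b :+ t :* l :+ s :* l := b :+ (t :+ s) :* l) refl (b 0) (t 0) s l ⟩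
    b 0 +ᶠ (t 0 +ᶠ s) *ᶠ l        ∎
    where
    s : Carrier
    s = sum {n} (t ∘ suc ∘ toℕ)

  -- Replaces the truncated difference that counts the summands by a number `n` of the form that
  -- `telescope` produces.
  ∑-length : ∀ f lo hi {n} → suc hi ∸ lo ≡ n → ∑[ lo ⋯ hi ] f ≈ sum {n} (λ k → f (lo + toℕ k))
  ∑-length f lo hi ≡.refl = refl

  -- The solver knows no subtraction, so the minus sign is the indeterminate ι,
  -- and 1# +ᶠ ι is cancelled by hand.
  ι : Carrier
  ι = - 1#

  absorb : ∀ {x} y → x +ᶠ (1# +ᶠ ι) *ᶠ y ≈ x
  absorb {x} y = begin
    x +ᶠ (1# +ᶠ ι) *ᶠ y ≈⟨ +-congˡ (*-congʳ (-‿inverseʳ 1#)) ⟩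
    x +ᶠ 0# *ᶠ y        ≈⟨ +-congˡ (zeroˡ y) ⟩
    x +ᶠ 0#             ≈⟨ +-identityʳ x ⟩
    x                   ∎

  ι*ι≈1 : ∀ x → ι *ᶠ (ι *ᶠ x) ≈ x
  ι*ι≈1 x = begin
    ι *ᶠ (ι *ᶠ x)                             ≈⟨ absorb x ⟨
    ι *ᶠ (ι *ᶠ x) +ᶠ (1# +ᶠ ι) *ᶠ x
      ≈⟨ solve 2 (λ i x → i :* (i :* x) :+ (con 1 :+ i) :* x := x :+ (con 1 :+ i) :* (i :* x)) refl ι x ⟩
    x +ᶠ (1# +ᶠ ι) *ᶠ (ι *ᶠ x)                ≈⟨ absorb (ι *ᶠ x) ⟩
    x                                         ∎

  Vector : Set c
  Vector = Carrier × Carrier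

  det : Vector → Vector → Carrier
  det (u₁ , u₂) (v₁ , v₂) = u₁ *ᶠ v₂ +ᶠ ι *ᶠ (u₂ *ᶠ v₁)

  combine : Carrier → Vector → Carrier → Vector → Vector
  combine x (u₁ , u₂) y (v₁ , v₂) = x *ᶠ u₁ +ᶠ y *ᶠ v₁ , x *ᶠ u₂ +ᶠ y *ᶠ v₂

  plücker : ∀ a b c d → det a c *ᶠ det b d ≈ det a b *ᶠ det c d +ᶠ det b c *ᶠ det a d
  plücker a@(a₁ , a₂) b@(b₁ , b₂) c@(c₁ , c₂) d@(d₁ , d₂) = begin
    det a c *ᶠ det b d ≈⟨ absorb _ ⟨
    -- On the right-hand side two monomials, a₁b₂c₁d₂ and a₂b₁c₂d₁, occur with both signs and
    -- cancel; on the left they do not occur. The added multiple of `1# +ᶠ ι` supplies exactly these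
    -- pairs.
    det a c *ᶠ det b d +ᶠ (1# +ᶠ ι) *ᶠ (a₁ *ᶠ b₂ *ᶠ c₁ *ᶠ d₂ +ᶠ ι *ᶠ (a₂ *ᶠ b₁ *ᶠ c₂ *ᶠ d₁))
      ≈⟨ solve 9 (λ i a₁ a₂ b₁ b₂ c₁ c₂ d₁ d₂ →
           (a₁ :* c₂ :+ i :* (a₂ :* c₁)) :* (b₁ :* d₂ :+ i :* (b₂ :* d₁))
             :+ (con 1 :+ i) :* (a₁ :* b₂ :* c₁ :* d₂ :+ i :* (a₂ :* b₁ :* c₂ :* d₁))
           := (a₁ :* b₂ :+ i :* (a₂ :* b₁)) :* (c₁ :* d₂ :+ i :* (c₂ :* d₁))
             :+ (b₁ :* c₂ :+ i :* (b₂ :* c₁)) :* (a₁ :* d₂ :+ i :* (a₂ :* d₁)))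
           refl ι a₁ a₂ b₁ b₂ c₁ c₂ d₁ d₂ ⟩
    det a b *ᶠ det c d +ᶠ det b c *ᶠ det a d ∎

  det-self : ∀ u → det u u ≈ 0#
  det-self u@(u₁ , u₂) = begin
    det u u
      ≈⟨ solve 3 (λ i x y → x :* y :+ i :* (y :* x) := con 0 :+ (con 1 :+ i) :* (x :* y)) refl ι u₁ u₂ ⟩
    0# +ᶠ (1# +ᶠ ι) *ᶠ (u₁ *ᶠ u₂) ≈⟨ absorb _ ⟩
    0# ∎

  det-swap : ∀ u v → det u v ≈ ι *ᶠ det v u
  det-swap u@(u₁ , u₂) v@(v₁ , v₂) = begin
    det u v                                             ≈⟨ +-congʳ (ι*ι≈1 _) ⟨
    ι *ᶠ (ι *ᶠ (u₁ *ᶠ v₂)) +ᶠ ι *ᶠ (u₂ *ᶠ v₁)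
      ≈⟨ solve 5 (λ i u₁ u₂ v₁ v₂ → i :* (i :* (u₁ :* v₂)) :+ i :* (u₂ :* v₁)
           := i :* (v₁ :* u₂ :+ i :* (v₂ :* u₁))) refl ι u₁ u₂ v₁ v₂ ⟩
    ι *ᶠ det v u                                        ∎

  -- Consecutive fans lie on opposite sides of AB, where the order of the vertices is reversed.
  -- Carrying the side as a sign lets one computation serve every fan.
  sdet : Sign → Vector → Vector → Carrier
  sdet Sign.+ u v = det u v
  sdet Sign.- u v = det v u

  sdet-opposite : ∀ σ u v → sdet (opposite σ) u v ≡ sdet σ v u
  sdet-opposite Sign.+ u v = ≡.refl
  sdet-opposite Sign.- u v = ≡.refl

  sdet-self : ∀ σ u → sdet σ u u ≈ 0#
  sdet-self Sign.+ = det-self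
  sdet-self Sign.- = det-self

  sdet-swap : ∀ σ u v → sdet σ u v ≈ ι *ᶠ sdet σ v u
  sdet-swap Sign.+ u v = det-swap u v
  sdet-swap Sign.- u v = det-swap v u

  sdet-combine : ∀ σ w x u y v →
    sdet σ w (combine x u y v) ≈ x *ᶠ sdet σ w u +ᶠ y *ᶠ sdet σ w v
  sdet-combine Sign.+ (w₁ , w₂) x (u₁ , u₂) y (v₁ , v₂) =
    solve 9 (λ i w₁ w₂ x u₁ u₂ y v₁ v₂ →
      w₁ :* (x :* u₂ :+ y :* v₂) :+ i :* (w₂ :* (x :* u₁ :+ y :* v₁))
      := x :* (w₁ :* u₂ :+ i :* (w₂ :* u₁)) :+ y :* (w₁ :* v₂ :+ i :* (w₂ :* v₁)))
      refl ι w₁ w₂ x u₁ u₂ y v₁ v₂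
  sdet-combine Sign.- (w₁ , w₂) x (u₁ , u₂) y (v₁ , v₂) =
    solve 9 (λ i w₁ w₂ x u₁ u₂ y v₁ v₂ →
      (x :* u₁ :+ y :* v₁) :* w₂ :+ i :* ((x :* u₂ :+ y :* v₂) :* w₁)
      := x :* (u₁ :* w₂ :+ i :* (u₂ :* w₁)) :+ y :* (v₁ :* w₂ :+ i :* (v₂ :* w₁)))
      refl ι w₁ w₂ x u₁ u₂ y v₁ v₂

-- The order of ℤ and its reverse, indexed by a side of AB.

infix 4 _<[_]_

_<[_]_ : ℤ → Sign → ℤ → Set
u <[ Sign.+ ] v = u ℤ.< v
u <[ Sign.- ] v = v ℤ.< u

<[]-trans : ∀ σ {u v w} → u <[ σ ] v → v <[ σ ] w → u <[ σ ] w
<[]-trans Sign.+ p q = ℤ.<-trans p q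
<[]-trans Sign.- p q = ℤ.<-trans q p

<[]⇒≢ : ∀ σ {u v} → u <[ σ ] v → ¬ u ≡ v
<[]⇒≢ Sign.+ p ≡.refl = ℤ.<-irrefl ≡.refl p
<[]⇒≢ Sign.- p ≡.refl = ℤ.<-irrefl ≡.refl p

0<[]◃ : ∀ σ n → ℤ.0ℤ <[ σ ] σ ◃ suc n
0<[]◃ Sign.+ n = +<+ (s≤s z≤n)
0<[]◃ Sign.- n = -<+

◃<[]0 : ∀ σ n → σ ◃ suc n <[ opposite σ ] ℤ.0ℤ
◃<[]0 Sign.+ n = +<+ (s≤s z≤n)
◃<[]0 Sign.- n = -<+

◃-mono-<[] : ∀ σ {m n} → m < n → σ ◃ suc m <[ σ ] σ ◃ suc n
◃-mono-<[] Sign.+ m<n = +<+ (s≤s m<n)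
◃-mono-<[] Sign.- m<n = -<- m<n

-- Lambda lengths and the Ptolemy relation.

module LambdaLength {c ℓ₁ ℓ₂} (F : HeytingField c ℓ₁ ℓ₂)
                    (φ : ℤ → FieldProperties.Vector F) where

  open FieldNotation F
  open FieldProperties F
  open PolygonCluster F
  open SetoidReasoning setoid

  -- Taking the endpoints in increasing order makes the determinant symmetric in them, as the
  -- variable of an arc must be.
  len : ℤ → ℤ → Carrier
  len u v with u ℤ.<? v
  ... | yes _ = det (φ u) (φ v)
  ... | no  _ = det (φ v) (φ u)

  len-sdet : ∀ σ {u v} → u <[ σ ] v → len u v ≈ sdet σ (φ u) (φ v)
  len-sdet Sign.+ {u} {v} u<v with u ℤ.<? v
  ... | yes _  = refl
  ... | no u≮v = contradiction u<v u≮v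
  len-sdet Sign.- {u} {v} v<u with u ℤ.<? v
  ... | yes u<v = contradiction u<v (ℤ.<-asym v<u)
  ... | no _    = refl

  len-sym : ∀ u v → len u v ≈ len v u
  len-sym u v with ℤ.<-cmp u v
  ... | tri< u<v _ _ = trans (len-sdet Sign.+ u<v) (sym (len-sdet Sign.- u<v))
  ... | tri≈ _ ≡.refl _ = refl
  ... | tri> _ _ v<u = trans (len-sdet Sign.- v<u) (sym (len-sdet Sign.+ v<u))

  Ptolemy : (a b c d : ℤ) → Set ℓ₁
  Ptolemy a b c d = len a c *ᶠ len b d ≈ len a b *ᶠ len c d +ᶠ len b c *ᶠ len d a

  ptolemy-chain : ∀ {a b c d} → a ℤ.< b → b ℤ.< c → c ℤ.< d → Ptolemy a b c d
  ptolemy-chain {a} {b} {c} {d} a<b b<c c<d = begin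
    len a c *ᶠ len b d
      ≈⟨ *-cong (len-sdet Sign.+ (ℤ.<-trans a<b b<c)) (len-sdet Sign.+ (ℤ.<-trans b<c c<d)) ⟩
    det (φ a) (φ c) *ᶠ det (φ b) (φ d)
      ≈⟨ plücker (φ a) (φ b) (φ c) (φ d) ⟩
    det (φ a) (φ b) *ᶠ det (φ c) (φ d) +ᶠ det (φ b) (φ c) *ᶠ det (φ a) (φ d)
      ≈⟨ +-cong (*-cong (len-sdet Sign.+ a<b) (len-sdet Sign.+ c<d))
                (*-cong (len-sdet Sign.+ b<c)
                        (len-sdet Sign.- (ℤ.<-trans (ℤ.<-trans a<b b<c) c<d))) ⟨
    len a b *ᶠ len c d +ᶠ len b c *ᶠ len d a ∎

  -- Rotating the quadrilateral exchanges its diagonals and the two products of opposite sides.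
  -- Hence all four cases of `CyclicallyOrdered` reduce to an increasing chain.
  ptolemy-rotate : ∀ a b c d → Ptolemy b c d a → Ptolemy a b c d
  ptolemy-rotate a b c d eq = begin
    len a c *ᶠ len b d                       ≈⟨ *-congʳ (len-sym a c) ⟩
    len c a *ᶠ len b d                       ≈⟨ *-comm _ _ ⟩
    len b d *ᶠ len c a                       ≈⟨ eq ⟩
    len b c *ᶠ len d a +ᶠ len c d *ᶠ len a b
      ≈⟨ solve 4 (λ x y z w → x :* y :+ z :* w := w :* z :+ x :* y)
           refl (len b c) (len d a) (len c d) (len a b) ⟩
    len a b *ᶠ len c d +ᶠ len b c *ᶠ len d a ∎

  ptolemy : ∀ {a b c d} → CyclicallyOrdered a b c d → Ptolemy a b c d
  ptolemy (inj₁ (p , q , r)) = ptolemy-chain p q r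
  ptolemy {a} {b} {c} {d} (inj₂ (inj₁ (p , q , r))) =
    ptolemy-rotate a b c d (ptolemy-chain p q r)
  ptolemy {a} {b} {c} {d} (inj₂ (inj₂ (inj₁ (p , q , r)))) =
    ptolemy-rotate a b c d (ptolemy-rotate b c d a (ptolemy-chain p q r))
  ptolemy {a} {b} {c} {d} (inj₂ (inj₂ (inj₂ (p , q , r)))) =
    ptolemy-rotate a b c d (ptolemy-rotate b c d a (ptolemy-rotate c d a b (ptolemy-chain p q r)))

  Measures : Seed → Set (c ⊔ ℓ₁)
  Measures S = ∀ {u v y} → S u v y → y ≈ len u v

  -- Induction on the flips: by the Ptolemy relation, dividing the exchange polynomial by the length
  -- of the old diagonal gives the length of the new one.
  mutation-measures : ∀ {S₀ S} → Measures S₀ → MutationClass S₀ S → Measures S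
  mutation-measures m₀ initial = m₀
  mutation-measures m₀ (flip {S} {a} {b} {c} {d} {y₁} {y₂} {y₃} {y₄} y mc cyc ab bc cd da ac) = go
    where
    m : Measures S
    m = mutation-measures m₀ mc

    exchange : (y₁ *ᶠ y₃ +ᶠ y₂ *ᶠ y₄) / y ≈ len b d
    exchange = begin
      (y₁ *ᶠ y₃ +ᶠ y₂ *ᶠ y₄) *ᶠ y ⁻¹
        ≈⟨ *-congʳ (+-cong (*-cong (m ab) (m cd)) (*-cong (m bc) (m da))) ⟩
      (len a b *ᶠ len c d +ᶠ len b c *ᶠ len d a) *ᶠ y ⁻¹ ≈⟨ *-congʳ (ptolemy cyc) ⟨
      len a c *ᶠ len b d *ᶠ y ⁻¹                         ≈⟨ *-congʳ (*-congʳ (m ac)) ⟨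
      proj₁ y *ᶠ len b d *ᶠ y ⁻¹
        ≈⟨ solve 3 (λ y l z → y :* l :* z := l :* (y :* z)) refl (proj₁ y) (len b d) (y ⁻¹) ⟩
      len b d *ᶠ (proj₁ y *ᶠ y ⁻¹)                       ≈⟨ cancel _ y ⟩
      len b d                                            ∎

    go : Measures (Flipped S a b c d ((y₁ *ᶠ y₃ +ᶠ y₂ *ᶠ y₄) / y))
    go (kept s _) = m s
    go new        = exchange
    go new′       = trans exchange (len-sym b d)

-- Flips and the arcs they leave in place.

module Diagonals {c ℓ₁ ℓ₂} (F : HeytingField c ℓ₁ ℓ₂) where

  open FieldNotation F
  open PolygonCluster F

  -- A seed relates ordered pairs of vertices, and a flip reads its sides in one direction only;
  -- which direction depends on the side of AB.
  Both : Seed → ℤ → ℤ → Carrier → Set c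
  Both S u v y = S u v y × S v u y

  flip-oriented : ∀ σ {S₀ S a u w k y₁ y₂ y₃ y₄} (y : Carrier*) → MutationClass S₀ S →
    u <[ σ ] a → a <[ σ ] w → w <[ σ ] k →
    Both S u a y₁ → Both S a w y₂ → Both S w k y₃ → Both S k u y₄ →
    Both S u w (proj₁ y) →
    ∃[ S′ ] MutationClass S₀ S′ × (∃[ z ] Both S′ a k z) ×
      (∀ {v v′ z} → S v v′ z → ¬ SameArc v v′ u w → S′ v v′ z)
  flip-oriented Sign.+ y mc ua aw wk (ua∈ , _) (aw∈ , _) (wk∈ , _) (ku∈ , _) (uw∈ , _) =
    _ , flip y mc (inj₁ (ua , aw , wk)) ua∈ aw∈ wk∈ ku∈ uw∈ , (_ , new , new′) , kept
  -- The order is reversed, so the quadrilateral is traversed as u, k, w, a, and the new diagonal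
  -- first appears as ka.
  flip-oriented Sign.- y mc ua aw wk (_ , au∈) (_ , wa∈) (_ , kw∈) (_ , uk∈) (uw∈ , _) =
    _ , flip y mc (inj₂ (inj₁ (wk , aw , ua))) uk∈ kw∈ wa∈ au∈ uw∈ , (_ , new′ , new) , kept

-- Diagonals are flipped in the order of gluing. An arc with an endpoint of rank at least `r`
-- differs from every diagonal whose two endpoints have smaller rank, so it survives the flips of
-- those.
Far : ℕ → ℤ → ℤ → Set
Far r u v = r ≤ ∣ u ∣ ⊎ r ≤ ∣ v ∣

Far⇒¬SameArc : ∀ {r u v c w} → Far r u v → ∣ c ∣ < r → ∣ w ∣ < r → ¬ SameArc u v c w
Far⇒¬SameArc (inj₁ f) c< w< (inj₁ (≡.refl , _)) = ℕ.<⇒≱ c< f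
Far⇒¬SameArc (inj₂ f) c< w< (inj₁ (_ , ≡.refl)) = ℕ.<⇒≱ w< f
Far⇒¬SameArc (inj₁ f) c< w< (inj₂ (≡.refl , _)) = ℕ.<⇒≱ w< f
Far⇒¬SameArc (inj₂ f) c< w< (inj₂ (_ , ≡.refl)) = ℕ.<⇒≱ c< f

-- The pairs (i , s) for which W_{i+1,s} W_{i+1,s+1} is the outer edge of a triangle
-- of the i+1-st fan, where (0 , 0) is τ₁ with A in the role of W_{1,0}.
data Gluing : ℕ → ℕ → Set where
  first : Gluing 0 0
  later : ∀ {i s} → Gluing i (suc s)

-- Ranks and cyclic order of the vertices.

module Vertices (p : ℕ → ℕ) (N : ℕ) (p≥1 : ∀ i → 1 ≤ i → i ≤ N → 1 ≤ p i) where

  open Polygon p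

  -- `Gluing` excludes W_{i+1,1} for i ≥ 1: this is C_i, the centre of the preceding fan, which has
  -- a smaller rank.
  W-suc : ∀ {i s} → Gluing i s → W (suc i) (suc s) ≡ side (suc i) ◃ suc (suc (P i + s))
  W-suc first = ≡.refl
  W-suc (later {zero} {s}) = cong (Sign.- ◃_) (ℕ.+-comm (suc (suc s)) 1)
  W-suc (later {suc i} {s}) = cong (side (suc (suc i)) ◃_)
    (≡.trans (ℕ.+-comm _ 1) (cong suc (ℕ.+-suc (P (suc i)) (suc s))))

  ∣W-suc∣ : ∀ {i s} → Gluing i s → ∣ W (suc i) (suc s) ∣ ≡ suc (suc (P i + s))
  ∣W-suc∣ {i} g = ≡.trans (cong ∣_∣ (W-suc g)) (ℤ.abs-◃ (side (suc i)) _)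

  P-suc : ∀ i → P i + (p (suc i) + 1) ≡ P (suc i) + 1
  P-suc i = ≡.sym (ℕ.+-assoc (P i) (p (suc i)) 1)

  -- Recording the sign and a bound on the rank treats C₁ and the later centres alike.
  C-position : ∀ i → i ≤ N → ∃[ k ] k ≤ P i + 1 × C (suc i) ≡ side i ◃ suc k
  C-position zero    _ = 0 , z≤n , ≡.refl
  C-position (suc i) i<N with p (suc i) | p≥1 (suc i) (s≤s z≤n) i<N
  -- Since p_{i+1} ≥ 1, the vertex C_{i+2} is added within fan i+1, so `W-suc` gives its rank.
  ... | suc q | _ rewrite ℕ.+-comm q 1 =
    suc (P i + suc q) , ℕ.≤-reflexive (ℕ.+-comm 1 _) , W-suc (later {i} {q})

  W-position : ∀ i s → i ≤ N → ∃[ k ] k ≤ P i + suc s × W (suc i) (suc s) ≡ side (suc i) ◃ suc k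
  W-position zero    zero    _   = 1 , ℕ.≤-refl , ≡.refl
  -- W_{i+2,1} is C_{i+1}, and passing two fans back restores the side.
  W-position (suc i) zero    i<N =
    let k , k≤ , eq = C-position i (ℕ.<⇒≤ i<N) in
    k , ℕ.≤-trans k≤ (ℕ.+-monoˡ-≤ 1 (ℕ.m≤m+n (P i) (p (suc i)))) ,
    ≡.trans eq (cong (_◃ suc k) (≡.sym (opposite-involutive (side i))))
  W-position i       (suc s) _   =
    suc (P i + suc s) , ℕ.≤-reflexive (≡.sym (ℕ.+-suc (P i) (suc s))) , W-suc (later {i} {s})

  -- With `A<W` and `W<W` this puts C_{i+1}, A, W_{i+1,s+1}, W_{i+1,s+2} in the order that
  -- `flip-oriented` demands.
  C<A : ∀ i → i ≤ N → C (suc i) <[ side (suc i) ] A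
  C<A i i≤N =
    let k , _ , eq = C-position i i≤N in
    subst (_<[ side (suc i) ] A) (≡.sym eq) (◃<[]0 (side i) k)

  A<W : ∀ i s → i ≤ N → A <[ side (suc i) ] W (suc i) (suc s)
  A<W i s i≤N =
    let k , _ , eq = W-position i s i≤N in
    subst (A <[ side (suc i) ]_) (≡.sym eq) (0<[]◃ (side (suc i)) k)

  W<W : ∀ i s → i ≤ N → W (suc i) (suc s) <[ side (suc i) ] W (suc i) (suc (suc s))
  W<W i s i≤N =
    let k , k≤ , eq = W-position i s i≤N in
    ≡.subst₂ (_<[ side (suc i) ]_) (≡.sym eq) (≡.sym (W-suc (later {i} {s})))
      (◃-mono-<[] (side (suc i)) (s≤s k≤))

  ∣C∣< : ∀ i s → i ≤ N → ∣ C (suc i) ∣ < suc (suc (P i + suc s))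
  ∣C∣< i s i≤N =
    let k , k≤ , eq = C-position i i≤N in
    subst (_< suc (suc (P i + suc s))) (≡.sym (≡.trans (cong ∣_∣ eq) (ℤ.abs-◃ (side i) (suc k))))
      (s≤s (s≤s (ℕ.≤-trans k≤ (ℕ.+-monoʳ-≤ (P i) (s≤s z≤n)))))

  ∣W∣< : ∀ i s → i ≤ N → ∣ W (suc i) (suc s) ∣ < suc (suc (P i + suc s))
  ∣W∣< i s i≤N =
    let k , k≤ , eq = W-position i s i≤N in
    subst (_< suc (suc (P i + suc s))) (≡.sym (≡.trans (cong ∣_∣ eq) (ℤ.abs-◃ (side (suc i)) (suc k))))
      (s≤s (s≤s k≤))

-- Existence: flipping the diagonals in the order of gluing.

module Existence {c ℓ₁ ℓ₂} (F : HeytingField c ℓ₁ ℓ₂) (N : ℕ) (p : ℕ → ℕ)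
                 (p≥1 : ∀ i → 1 ≤ i → i ≤ N → 1 ≤ p i)
                 (xe xo : ℕ → FieldNotation.Carrier* F) where

  open FieldNotation F
  open PolygonCluster F
  open Diagonals F
  open Polygon p
  open Triangulation F N xe xo
  open Vertices p N p≥1

  -- The last edge of a fan is either the first diagonal of the next fan, with centre and outer
  -- vertex exchanged, or the boundary edge VB.
  e-end : ∀ {i} → suc i ≤ N →
          InitialSeed (C (suc i)) (W (suc i) (p (suc i) + 1)) x[e P i + (p (suc i) + 1) ]
  e-end {i} i<N =
    subst (λ r → InitialSeed (C (suc i)) (W (suc i) (p (suc i) + 1)) x[e r ]) (≡.sym (P-suc i))
      (end (ℕ.m≤n⇒m<n∨m≡n i<N))
    where
    end : suc i < N ⊎ suc i ≡ N →
          InitialSeed (C (suc i)) (W (suc i) (p (suc i) + 1)) x[e P (suc i) + 1 ]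
    end (inj₁ i+1<N) = swap (e-inner i+1<N ℕ.≤-refl (p≥1 (suc (suc i)) (s≤s z≤n) i+1<N))
    end (inj₂ i+1≡N) =
      subst (λ n → InitialSeed (C n) (W n (p n + 1)) x[e P n + 1 ]) (≡.sym i+1≡N) e-last

  e-next : ∀ {i s} → suc i ≤ N → s < p (suc i) →
           InitialSeed (C (suc i)) (W (suc i) (suc (suc s))) x[e P i + suc (suc s) ]
  e-next {i} {s} i<N s<p with ℕ.m≤n⇒m<n∨m≡n s<p
  ... | inj₁ s+1<p = e-inner i<N (s≤s z≤n) s+1<p
  ... | inj₂ s+1≡p =
    subst (λ n → InitialSeed (C (suc i)) (W (suc i) n) x[e P i + n ])
      (≡.trans (ℕ.+-comm (p (suc i)) 1) (cong suc (≡.sym s+1≡p))) (e-end i<N)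

  o-next : ∀ {i s} → suc i ≤ N → s < p (suc i) →
           InitialSeed (W (suc i) (suc s)) (W (suc i) (suc (suc s))) x[o P i + 1 + suc s ]
  o-next {i} {s} i<N s<p =
    subst (λ n → InitialSeed (W (suc i) (suc s)) (W (suc i) n) x[o P i + 1 + suc s ]) (ℕ.+-comm (suc s) 1)
      (o-outer i<N (s≤s z≤n) s<p)

  -- The state reached by flipping e_1, e_2, … up to the diagonal before C_{i+1} W_{i+1,s}.
  record Fanned (i s : ℕ) : Set (lsuc c ⊔ ℓ₂) where
    field
      {seed}    : Seed
      reachable : MutationClass InitialSeed seed
      AC        : ∃[ y ] Both seed A (C (suc i)) y
      AW        : ∃[ y ] Both seed A (W (suc i) s) y
      CW        : Both seed (C (suc i)) (W (suc i) s) x[e P i + s ]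
      unflipped : ∀ {u v y} → InitialSeed u v y → Far (suc (suc (P i + s))) u v → seed u v y

  open Fanned

  start : 1 ≤ N → Fanned 0 1
  start 1≤N = record
    { reachable = initial
    ; AC        = _ , e-first , swap e-first
    ; AW        = _ , o-first , swap o-first
    ; CW        = e₁ , swap e₁
    ; unflipped = λ a _ → a
    }
    where
    e₁ : InitialSeed (C 1) (W 1 1) x[e P 0 + 1 ]
    e₁ = e-inner 1≤N ℕ.≤-refl (p≥1 1 ℕ.≤-refl 1≤N)

  -- Flips C_{i+1}W_{i+1,s+1} to A W_{i+1,s+2}. The two sides not at A are still initial arcs, and
  -- the divisor is the initial variable of the flipped diagonal.
  advance : ∀ {i s} → suc i ≤ N → s < p (suc i) → Fanned i (suc s) → Fanned i (suc (suc s))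
  advance {i} {s} i<N s<p f =
    let S′ , mc , A-next , keep =
          flip-oriented (side (suc i)) (xe (P i + suc s)) (reachable f)
            (C<A i i≤N) (A<W i s i≤N) (W<W i s i≤N)
            (×-swap (proj₂ (AC f))) (proj₂ (AW f))
            (unflippedᵇ (o-next i<N s<p)) (×-swap (unflippedᵇ (e-next i<N s<p)))
            (CW f)
        keepFar : ∀ {u v y} → InitialSeed u v y → Far r u v → S′ u v y
        keepFar = λ a far → keep (unflipped f a far) (Far⇒¬SameArc far (∣C∣< i s i≤N) (∣W∣< i s i≤N))
        y , AC∈ , CA∈ = AC f
    in record
    { reachable = mc
    ; AC        = y , keep AC∈ (λ { (inj₁ (A≡C , _)) → <[]⇒≢ σ (C<A i i≤N) (≡.sym A≡C)
                                  ; (inj₂ (A≡W , _)) → <[]⇒≢ σ (A<W i s i≤N) A≡W })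
                    , keep CA∈ (λ { (inj₁ (_ , A≡W)) → <[]⇒≢ σ (A<W i s i≤N) A≡W
                                  ; (inj₂ (_ , A≡C)) → <[]⇒≢ σ (C<A i i≤N) (≡.sym A≡C) })
    ; AW        = A-next
    ; CW        = keepFar (e-next i<N s<p) (inj₂ far-next)
                  , keepFar (swap (e-next i<N s<p)) (inj₁ far-next)
    ; unflipped = λ a far → keepFar a (map weaken weaken far)
    }
    where
    r : ℕ
    r = suc (suc (P i + suc s))
    σ : Sign
    σ = side (suc i)
    i≤N : i ≤ N
    i≤N = ℕ.<⇒≤ i<N
    far-next : r ≤ ∣ W (suc i) (suc (suc s)) ∣
    far-next = ℕ.≤-reflexive (≡.sym (∣W-suc∣ (later {i} {s})))
    unflippedᵇ : ∀ {u y} → InitialSeed u (W (suc i) (suc (suc s))) y →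
                 Both (seed f) u (W (suc i) (suc (suc s))) y
    unflippedᵇ a = unflipped f a (inj₂ far-next) , unflipped f (swap a) (inj₁ far-next)
    weaken : ∀ {n} → suc (suc (P i + suc (suc s))) ≤ n → r ≤ n
    weaken = ℕ.≤-trans (s≤s (s≤s (ℕ.+-monoʳ-≤ (P i) (ℕ.n≤1+n (suc s)))))

  -- No flip takes place: C_{i+2} is the last W of the old fan and W_{i+2,1} is the old centre, so
  -- the two arcs from A exchange roles.
  next-fan : ∀ {i} → Fanned i (p (suc i) + 1) → Fanned (suc i) 1
  next-fan {i} f = record
    { reachable = reachable f
    ; AC        = AW f
    ; AW        = AC f
    ; CW        = subst (λ r → Both (seed f) (W (suc i) (p (suc i) + 1)) (C (suc i)) x[e r ])
                      (P-suc i) (×-swap (CW f))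
    ; unflipped = λ {u} {v} a far →
        unflipped f a (subst (λ r → Far (suc (suc r)) u v) (≡.sym (P-suc i)) far)
    }

  reach     : ∀ i s → suc i ≤ N → s ≤ p (suc i) → Fanned i (suc s)
  reach-end : ∀ i → suc i ≤ N → Fanned i (p (suc i) + 1)

  reach zero    zero    i<N _   = start i<N
  reach (suc i) zero    i<N _   = next-fan (reach-end i (ℕ.<⇒≤ i<N))
  reach i       (suc s) i<N s<p = advance i<N s<p (reach i s i<N (ℕ.<⇒≤ s<p))

  reach-end i i<N =
    subst (Fanned i) (ℕ.+-comm 1 (p (suc i))) (reach i (p (suc i)) i<N ℕ.≤-refl)

  D-exists : ∀ i → 1 ≤ i → i ≤ N → ∃[ y ] IsD i y
  D-exists (suc i) _ i<N =
    let y , AW∈ , _ = AW (reach-end i i<N) in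
    y , seed (reach-end i i<N) , reachable (reach-end i i<N) , y , AW∈ , FieldProperties.refl F

-- Vectors of the vertices, built by gluing triangles.

module Coordinates {c ℓ₁ ℓ₂} (F : HeytingField c ℓ₁ ℓ₂) (N : ℕ) (p : ℕ → ℕ)
                   (p≥1 : ∀ i → 1 ≤ i → i ≤ N → 1 ≤ p i)
                   (xe xo : ℕ → FieldNotation.Carrier* F) where

  open FieldNotation F
  open FieldProperties F
  open Polygon p
  open Triangulation F N xe xo
  open Vertices p N p≥1
  open SetoidReasoning setoid

  -- The vectors of A and C₁, chosen with determinant x(e₀); the others arise from them by `glue`.
  α γ : Vector
  α = 1# , 0#
  γ = 0# , x[e 0 ]

  det-αγ : det α γ ≈ x[e 0 ]
  det-αγ = begin
    1# *ᶠ x[e 0 ] +ᶠ ι *ᶠ (0# *ᶠ 0#) ≈⟨ +-cong (*-identityˡ _) (trans (*-congˡ (zeroˡ 0#)) (zeroʳ ι)) ⟩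
    x[e 0 ] +ᶠ 0#                    ≈⟨ +-identityʳ _ ⟩
    x[e 0 ]                          ∎

  -- The third vertex of τ_{r+1}, given the endpoints c and w of e_r, where c is the
  -- common endpoint of e_r and e_{r+1}.
  glue : ℕ → Vector → Vector → Vector
  glue r c w = combine (x[e suc r ] *ᶠ xe r ⁻¹) w (ι *ᶠ (x[o suc r ] *ᶠ xe r ⁻¹)) c

  module _ (σ : Sign) (r : ℕ) (c w : Vector) where

    private
      f : Carrier
      f = xe r ⁻¹

    -- The determinant with `c` kills the multiple of `c`, and the coefficient of `w` turns x(e_r)
    -- into x(e_{r+1}).
    sdet-glue-e : sdet σ c w ≈ x[e r ] → sdet σ c (glue r c w) ≈ x[e suc r ]
    sdet-glue-e cw = begin
      sdet σ c (glue r c w)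
        ≈⟨ sdet-combine σ c _ w _ c ⟩
      x[e suc r ] *ᶠ f *ᶠ sdet σ c w +ᶠ ι *ᶠ (x[o suc r ] *ᶠ f) *ᶠ sdet σ c c
        ≈⟨ +-cong (*-congˡ cw) (trans (*-congˡ (sdet-self σ c)) (zeroʳ _)) ⟩
      x[e suc r ] *ᶠ f *ᶠ x[e r ] +ᶠ 0#
        ≈⟨ +-identityʳ _ ⟩
      x[e suc r ] *ᶠ f *ᶠ x[e r ]
        ≈⟨ solve 3 (λ x f e → x :* f :* e := x :* (e :* f)) refl x[e suc r ] f x[e r ] ⟩
      x[e suc r ] *ᶠ (x[e r ] *ᶠ f)
        ≈⟨ cancel _ (xe r) ⟩
      x[e suc r ] ∎

    sdet-glue : ∀ a → sdet σ a (glue r c w) ≈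
                      x[e suc r ] *ᶠ f *ᶠ sdet σ a w +ᶠ x[o suc r ] *ᶠ f *ᶠ sdet σ c a
    sdet-glue a = begin
      sdet σ a (glue r c w)
        ≈⟨ sdet-combine σ a _ w _ c ⟩
      x[e suc r ] *ᶠ f *ᶠ sdet σ a w +ᶠ ι *ᶠ (x[o suc r ] *ᶠ f) *ᶠ sdet σ a c
        -- Swapping the arguments yields a second `ι`, which cancels the minus sign in `glue`.
        ≈⟨ +-congˡ (trans (*-assoc _ _ _) (trans (*-congˡ (*-congˡ (sdet-swap σ a c)))
             (solve 3 (λ i o d → i :* (o :* (i :* d)) := i :* (i :* (o :* d)))
               refl ι (x[o suc r ] *ᶠ f) (sdet σ c a)))) ⟩
      x[e suc r ] *ᶠ f *ᶠ sdet σ a w +ᶠ ι *ᶠ (ι *ᶠ (x[o suc r ] *ᶠ f *ᶠ sdet σ c a))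
        ≈⟨ +-congˡ (ι*ι≈1 _) ⟩
      x[e suc r ] *ᶠ f *ᶠ sdet σ a w +ᶠ x[o suc r ] *ᶠ f *ᶠ sdet σ c a ∎

    sdet-glue-o : sdet σ c w ≈ x[e r ] → sdet σ w (glue r c w) ≈ x[o suc r ]
    sdet-glue-o cw = begin
      sdet σ w (glue r c w)
        ≈⟨ sdet-glue w ⟩
      x[e suc r ] *ᶠ f *ᶠ sdet σ w w +ᶠ x[o suc r ] *ᶠ f *ᶠ sdet σ c w
        ≈⟨ +-cong (trans (*-congˡ (sdet-self σ w)) (zeroʳ _)) (*-congˡ cw) ⟩
      0# +ᶠ x[o suc r ] *ᶠ f *ᶠ x[e r ]
        ≈⟨ solve 3 (λ x f e → con 0 :+ x :* f :* e := x :* (e :* f)) refl x[o suc r ] f x[e r ] ⟩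
      x[o suc r ] *ᶠ (x[e r ] *ᶠ f)
        ≈⟨ cancel _ (xe r) ⟩
      x[o suc r ] ∎

    -- After division by x(e_{r+1}) the previous value enters with coefficient 1, and the increment
    -- is a multiple of a determinant that involves only the centre and `a`. This makes the fan
    -- telescope.
    sdet-glue-normalised : ∀ a →
      sdet σ a (glue r c w) *ᶠ xe (suc r) ⁻¹ ≈
      sdet σ a w *ᶠ xe r ⁻¹ +ᶠ term (suc r) *ᶠ sdet σ c a
    sdet-glue-normalised a = begin
      sdet σ a (glue r c w) *ᶠ g
        ≈⟨ *-congʳ (sdet-glue a) ⟩
      (x[e suc r ] *ᶠ f *ᶠ sdet σ a w +ᶠ x[o suc r ] *ᶠ f *ᶠ sdet σ c a) *ᶠ g
        ≈⟨ solve 6 (λ e f g x o y → (e :* f :* x :+ o :* f :* y) :* g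
                                  := x :* f :* (e :* g) :+ o :* (f :* g) :* y)
             refl x[e suc r ] f g (sdet σ a w) x[o suc r ] (sdet σ c a) ⟩
      sdet σ a w *ᶠ f *ᶠ (x[e suc r ] *ᶠ g) +ᶠ x[o suc r ] *ᶠ (f *ᶠ g) *ᶠ sdet σ c a
        ≈⟨ +-cong (cancel _ (xe (suc r))) (*-congʳ (*-congˡ (sym (·-⁻¹ (xe r) (xe (suc r)))))) ⟩
      sdet σ a w *ᶠ f +ᶠ term (suc r) *ᶠ sdet σ c a ∎
      where
      g : Carrier
      g = xe (suc r) ⁻¹

  -- vC i and vW i s belong to C_{i+1} and W_{i+1,s}; the value of vW (suc i) 0 is junk.
  vC : ℕ → Vector
  vW : ℕ → ℕ → Vector

  vC zero    = γ
  vC (suc i) = vW i (p (suc i) + 1)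

  vW zero    zero          = α
  vW zero    (suc s)       = glue s (vC 0) (vW 0 s)
  vW (suc i) zero          = α
  vW (suc i) 1             = vC i
  vW (suc i) (suc (suc s)) = glue (P (suc i) + suc s) (vC (suc i)) (vW (suc i) (suc s))

  vW-suc : ∀ {i s} → Gluing i s → vW i (suc s) ≡ glue (P i + s) (vC i) (vW i s)
  vW-suc first           = ≡.refl
  vW-suc (later {zero})  = ≡.refl
  vW-suc (later {suc _}) = ≡.refl

  gluing-0 : ∀ s → Gluing 0 s
  gluing-0 zero    = first
  gluing-0 (suc s) = later

  sdet-CW : ∀ i s → Gluing i s → sdet (side (suc i)) (vC i) (vW i s) ≈ x[e P i + s ]
  sdet-CW zero zero _ = det-αγ
  sdet-CW zero (suc s) _ =
    sdet-glue-e (side 1) s (vC 0) (vW 0 s) (sdet-CW 0 s (gluing-0 s))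
  -- The first diagonal of a fan is the last one of the preceding fan: centre and outer vertex are
  -- exchanged, and the opposite side compensates for this.
  sdet-CW (suc i) 1 _ = begin
    sdet (side (suc (suc i))) (vW i (p (suc i) + 1)) (vC i)
      ≡⟨ sdet-opposite (side (suc i)) _ _ ⟩
    sdet (side (suc i)) (vC i) (vW i (p (suc i) + 1))
      ≈⟨ sdet-CW i (p (suc i) + 1) (subst (Gluing i) (ℕ.+-comm 1 (p (suc i))) later) ⟩
    x[e P i + (p (suc i) + 1) ]
      ≡⟨ cong (λ r → x[e r ]) (P-suc i) ⟩
    x[e P (suc i) + 1 ] ∎
  sdet-CW (suc i) (suc (suc s)) _ = begin
    sdet (side (suc (suc i))) (vC (suc i)) (vW (suc i) (suc (suc s)))
      ≈⟨ sdet-glue-e (side (suc (suc i))) (P (suc i) + suc s) (vC (suc i)) (vW (suc i) (suc s))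
           (sdet-CW (suc i) (suc s) later) ⟩
    x[e suc (P (suc i) + suc s) ]
      ≡⟨ cong (λ r → x[e r ]) (ℕ.+-suc (P (suc i)) (suc s)) ⟨
    x[e P (suc i) + suc (suc s) ] ∎

  sdet-WW : ∀ {i s} → Gluing i s →
            sdet (side (suc i)) (vW i s) (vW i (suc s)) ≈ x[o P i + 1 + s ]
  sdet-WW {i} {s} g = begin
    sdet (side (suc i)) (vW i s) (vW i (suc s))
      ≡⟨ cong (sdet (side (suc i)) (vW i s)) (vW-suc g) ⟩
    sdet (side (suc i)) (vW i s) (glue (P i + s) (vC i) (vW i s))
      ≈⟨ sdet-glue-o (side (suc i)) (P i + s) (vC i) (vW i s) (sdet-CW i s g) ⟩
    x[o suc (P i + s) ]
      ≡⟨ cong (λ n → x[o n + s ]) (ℕ.+-comm 1 (P i)) ⟩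
    x[o P i + 1 + s ] ∎

  -- From ranks to vectors.

  -- The n-th vector from vW i s on in the order of gluing, if k vertices of the
  -- i+1-st fan follow.
  nth : (i s k n : ℕ) → Vector
  nth i s k       zero    = vW i s
  nth i s zero    (suc n) = nth (suc i) 2 (pred (p (suc (suc i)))) n
  nth i s (suc k) (suc n) = nth i (suc s) k n

  ranked : ℕ → Vector
  ranked 0             = α
  ranked 1             = γ
  ranked (suc (suc n)) = nth 0 1 (p 1) n

  -- Distinct vertices of the polygon have distinct absolute values, so the rank determines the
  -- vector.
  φ : ℤ → Vector
  φ z = ranked ∣ z ∣

  nth-within : ∀ i s k n → n ≤ k → nth i s k n ≡ vW i (s + n)
  nth-within i s k       zero    _         = cong (vW i) (≡.sym (ℕ.+-identityʳ s))
  nth-within i s (suc k) (suc n) (s≤s n≤k) =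
    ≡.trans (nth-within i (suc s) k n n≤k) (cong (vW i) (≡.sym (ℕ.+-suc s n)))

  nth-beyond : ∀ i s k n →
               nth i s k (k + suc n) ≡ nth (suc i) 2 (pred (p (suc (suc i)))) n
  nth-beyond i s zero    n = ≡.refl
  nth-beyond i s (suc k) n = nth-beyond i (suc s) k n

  -- Induction on the fans. A fan after the first is entered at index 2, because its W at index 1 is
  -- a centre ranked earlier; `pred p` further vertices then follow.
  nth-fan : ∀ i n → suc i ≤ N →
            nth 0 1 (p 1) (P (suc i) + suc n) ≡ nth (suc i) 2 (pred (p (suc (suc i)))) n
  nth-fan zero    n _   = nth-beyond 0 1 (p 1) n
  nth-fan (suc i) n i<N
    -- Positivity lets `pred` reduce; the induction hypothesis is abstracted too, since its type
    -- mentions the same value of `p`.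
    with p (suc (suc i)) | p≥1 (suc (suc i)) (s≤s z≤n) i<N | nth-fan i
  ... | suc q | _ | ih =
    ≡.trans (cong (nth 0 1 (p 1)) (ℕ.+-assoc (P (suc i)) (suc q) (suc n)))
      (≡.trans (ih (q + suc n) (ℕ.<⇒≤ i<N)) (nth-beyond (suc i) 2 q n))

  ranked-W : ∀ i s → suc i ≤ N → suc s ≤ p (suc i) →
             ranked (suc (suc (P i + suc s))) ≡ vW i (suc (suc s))
  ranked-W zero    s _   s<p = nth-within 0 1 (p 1) (suc s) s<p
  ranked-W (suc i) s i<N s<p =
    ≡.trans (nth-fan i s (ℕ.<⇒≤ i<N))
      (nth-within (suc i) 2 (pred (p (suc (suc i)))) s (ℕ.pred-mono-≤ s<p))

  φ-C : ∀ i → i ≤ N → φ (C (suc i)) ≡ vC i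
  φ-W : ∀ i s → suc i ≤ N → s ≤ p (suc i) → φ (W (suc i) (suc s)) ≡ vW i (suc s)

  φ-C zero    _   = ≡.refl
  φ-C (suc i) i<N =
    subst (λ n → φ (W (suc i) n) ≡ vW i n) (ℕ.+-comm 1 (p (suc i)))
      (φ-W i (p (suc i)) i<N ℕ.≤-refl)

  φ-W zero    zero    _   _   = ≡.refl
  φ-W (suc i) zero    i<N _   = φ-C i (ℕ.<⇒≤ (ℕ.<⇒≤ i<N))
  φ-W i       (suc s) i<N s<p =
    ≡.trans (cong ranked (∣W-suc∣ (later {i} {s}))) (ranked-W i s i<N s<p)

  -- Lengths of the initial arcs.

  open LambdaLength F φ

  len-CW : ∀ i s → suc i ≤ N → s ≤ p (suc i) →
           len (C (suc i)) (W (suc i) (suc s)) ≈ x[e P i + suc s ]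
  len-CW i s i<N s≤p = begin
    len (C (suc i)) (W (suc i) (suc s))
      ≈⟨ len-sdet σ (<[]-trans σ (C<A i i≤N) (A<W i s i≤N)) ⟩
    sdet σ (φ (C (suc i))) (φ (W (suc i) (suc s)))
      ≡⟨ ≡.cong₂ (sdet σ) (φ-C i i≤N) (φ-W i s i<N s≤p) ⟩
    sdet σ (vC i) (vW i (suc s))
      ≈⟨ sdet-CW i (suc s) later ⟩
    x[e P i + suc s ] ∎
    where
    σ : Sign
    σ = side (suc i)
    i≤N : i ≤ N
    i≤N = ℕ.<⇒≤ i<N

  len-C-end : ∀ i → 1 ≤ i → i ≤ N → len (C i) (W i (p i + 1)) ≈ x[e P i + 1 ]
  len-C-end (suc i) _ i<N = begin
    len (C (suc i)) (W (suc i) (p (suc i) + 1))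
      ≡⟨ cong (λ n → len (C (suc i)) (W (suc i) n)) (ℕ.+-comm (p (suc i)) 1) ⟩
    len (C (suc i)) (W (suc i) (suc (p (suc i))))
      ≈⟨ len-CW i (p (suc i)) i<N ℕ.≤-refl ⟩
    x[e P i + suc (p (suc i)) ]
      ≡⟨ cong (λ n → x[e P i + n ]) (ℕ.+-comm 1 (p (suc i))) ⟩
    x[e P i + (p (suc i) + 1) ]
      ≡⟨ cong (λ r → x[e r ]) (P-suc i) ⟩
    x[e P (suc i) + 1 ] ∎

  len-WW : ∀ i s → suc i ≤ N → s < p (suc i) →
           len (W (suc i) (suc s)) (W (suc i) (suc s + 1)) ≈ x[o P i + 1 + suc s ]
  len-WW i s i<N s<p = begin
    len (W (suc i) (suc s)) (W (suc i) (suc s + 1))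
      ≡⟨ cong (λ n → len (W (suc i) (suc s)) (W (suc i) n)) (ℕ.+-comm (suc s) 1) ⟩
    len (W (suc i) (suc s)) (W (suc i) (suc (suc s)))
      ≈⟨ len-sdet σ (W<W i s (ℕ.<⇒≤ i<N)) ⟩
    sdet σ (φ (W (suc i) (suc s))) (φ (W (suc i) (suc (suc s))))
      ≡⟨ ≡.cong₂ (sdet σ) (φ-W i s i<N (ℕ.<⇒≤ s<p)) (φ-W i (suc s) i<N s<p) ⟩
    sdet σ (vW i (suc s)) (vW i (suc (suc s)))
      ≈⟨ sdet-WW {i} later ⟩
    x[o P i + 1 + suc s ] ∎
    where
    σ : Sign
    σ = side (suc i)

  len-AW : ∀ i s → suc i ≤ N → s ≤ p (suc i) →
           len A (W (suc i) (suc s)) ≈ sdet (side (suc i)) α (vW i (suc s))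
  len-AW i s i<N s≤p = trans (len-sdet (side (suc i)) (A<W i s (ℕ.<⇒≤ i<N)))
    (reflexive (cong (sdet (side (suc i)) α) (φ-W i s i<N s≤p)))

  -- The recurrence along a fan.

  -- The determinant form of D^{[p₁,...,p_i]}: for i ≥ 1 the endpoint W_{i,p_i+1} is C_{i+1}, and i
  -- = 0 gives AC₁, in agreement with the convention D^{[]} = x(e₀).
  ΔA : ℕ → Carrier
  ΔA i = sdet (side (suc i)) (vC i) α

  ΔA-suc : ∀ i → ΔA (suc i) ≡ sdet (side (suc i)) α (vW i (p (suc i) + 1))
  ΔA-suc i = sdet-opposite (side (suc i)) _ _

  normalised : ℕ → ℕ → Carrier
  normalised i s = sdet (side (suc i)) α (vW i s) *ᶠ xe (P i + s) ⁻¹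

  normalised-suc : ∀ {i s} → Gluing i s →
    normalised i (suc s) ≈ normalised i s +ᶠ term (P i + suc s) *ᶠ ΔA i
  normalised-suc {i} {s} g rewrite vW-suc g | ℕ.+-suc (P i) s =
    sdet-glue-normalised (side (suc i)) (P i + s) (vC i) (vW i s) α

  denormalise : ∀ i → ΔA (suc i) ≈ x[e P (suc i) + 1 ] *ᶠ normalised i (suc (p (suc i)))
  denormalise i = begin
    ΔA (suc i)
      ≡⟨ ΔA-suc i ⟩
    d (p (suc i) + 1)
      ≈⟨ cancel _ (xe (P i + (p (suc i) + 1))) ⟨
    d (p (suc i) + 1) *ᶠ (x[e P i + (p (suc i) + 1) ] *ᶠ xe (P i + (p (suc i) + 1)) ⁻¹)
      ≈⟨ solve 3 (λ d e f → d :* (e :* f) := e :* (d :* f)) refl _ _ _ ⟩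
    x[e P i + (p (suc i) + 1) ] *ᶠ normalised i (p (suc i) + 1)
      ≡⟨ ≡.cong₂ (λ r n → x[e r ] *ᶠ normalised i n) (P-suc i) (ℕ.+-comm (p (suc i)) 1) ⟩
    x[e P (suc i) + 1 ] *ᶠ normalised i (suc (p (suc i))) ∎
    where
    d : ℕ → Carrier
    d n = sdet (side (suc i)) α (vW i n)

  ΔA-one : ΔA 1 ≈ x[e 0 ] *ᶠ x[e p 1 + 1 ] *ᶠ ∑[ 1 ⋯ p 1 + 1 ] term
  ΔA-one = begin
    ΔA 1
      ≈⟨ denormalise 0 ⟩
    x[e p 1 + 1 ] *ᶠ normalised 0 (suc (p 1))
      ≈⟨ *-congˡ (telescope (normalised 0) (term ∘ suc) (ΔA 0) (suc (p 1))
           (λ k → normalised-suc (gluing-0 k))) ⟩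
    x[e p 1 + 1 ] *ᶠ (normalised 0 0 +ᶠ sum {suc (p 1)} (term ∘ suc ∘ toℕ) *ᶠ ΔA 0)
      -- The first fan is extended back to A in the role of W_{1,0}. Its starting value is the
      -- determinant of `α` with itself, so it vanishes, and the sum begins with τ₁.
      ≈⟨ *-congˡ (+-cong (trans (*-congʳ (sdet-self (side 1) α)) (zeroˡ _))
           (*-cong (sym (∑-length term 1 (p 1 + 1) (ℕ.+-comm (p 1) 1))) det-αγ)) ⟩
    x[e p 1 + 1 ] *ᶠ (0# +ᶠ ∑[ 1 ⋯ p 1 + 1 ] term *ᶠ x[e 0 ])
      ≈⟨ solve 3 (λ e s x → e :* (con 0 :+ s :* x) := x :* e :* s) refl _ _ _ ⟩
    x[e 0 ] *ᶠ x[e p 1 + 1 ] *ᶠ ∑[ 1 ⋯ p 1 + 1 ] term ∎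

  ΔA-recurrence : ∀ i → ΔA (suc (suc i)) ≈
    (x[e P (suc (suc i)) + 1 ] / xe (P (suc i) + 1)) *ᶠ ΔA i
      +ᶠ x[e P (suc (suc i)) + 1 ] *ᶠ (∑[ P (suc i) + 2 ⋯ P (suc (suc i)) + 1 ] term) *ᶠ ΔA (suc i)
  ΔA-recurrence i = begin
    ΔA (suc (suc i))
      ≈⟨ denormalise (suc i) ⟩
    e *ᶠ normalised (suc i) (suc n)
      -- This fan starts at W_{i+2,1} = C_{i+1}: the initial value becomes `ΔA i` divided by the
      -- variable of its first diagonal, and the first triangle has index `P (suc i) + 2`.
      ≈⟨ *-congˡ (telescope (normalised (suc i) ∘ suc) (λ k → term (P (suc i) + suc (suc k)))
           (ΔA (suc i)) n (λ _ → normalised-suc later)) ⟩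
    e *ᶠ (normalised (suc i) 1 +ᶠ sum {n} (λ k → term (P (suc i) + suc (suc (toℕ k)))) *ᶠ ΔA (suc i))
      ≈⟨ *-congˡ (+-cong
           (*-congʳ (reflexive (sdet-opposite (side (suc i)) α (vC i))))
           (*-congʳ (trans
             (sum-cong-≋ {n} (λ k → reflexive (cong term (≡.sym (ℕ.+-assoc (P (suc i)) 2 (toℕ k))))))
             (sym (∑-length term (P (suc i) + 2) (P (suc (suc i)) + 1) length≡))))) ⟩
    e *ᶠ (ΔA i *ᶠ f +ᶠ S *ᶠ ΔA (suc i))
      ≈⟨ solve 5 (λ e x f s y → e :* (x :* f :+ s :* y) := e :* f :* x :+ e :* s :* y)
           refl e (ΔA i) f S (ΔA (suc i)) ⟩
    e *ᶠ f *ᶠ ΔA i +ᶠ e *ᶠ S *ᶠ ΔA (suc i) ∎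
    where
    n : ℕ
    n = p (suc (suc i))
    e f S : Carrier
    e = x[e P (suc (suc i)) + 1 ]
    f = xe (P (suc i) + 1) ⁻¹
    S = ∑[ P (suc i) + 2 ⋯ P (suc (suc i)) + 1 ] term
    length≡ : suc (P (suc i) + n + 1) ∸ (P (suc i) + 2) ≡ n
    length≡ = ≡.trans
      (cong (_∸ (P (suc i) + 2)) (≡.trans (cong suc (ℕ.+-assoc (P (suc i)) n 1))
        (≡.trans (≡.sym (ℕ.+-suc (P (suc i)) (n + 1)))
          (cong (λ m → P (suc i) + suc m) (ℕ.+-comm n 1)))))
      (ℕ.[m+n]∸[m+o]≡n∸o (P (suc i)) (suc (suc n)) 2)

  -- From determinants to cluster variables.

  module _ (1≤N : 1 ≤ N) where

    initial-measures : Measures InitialSeed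
    initial-measures e-first = begin
      x[e 0 ]       ≈⟨ det-αγ ⟨
      det α γ       ≈⟨ len-sdet Sign.- (C<A 0 z≤n) ⟨
      len (C 1) A   ≈⟨ len-sym (C 1) A ⟩
      len A (C 1)   ∎
    initial-measures (e-inner {i} {suc s} i<N _ s≤p) = sym (len-CW i s i<N (ℕ.<⇒≤ s≤p))
    initial-measures e-last = sym (len-C-end N 1≤N ℕ.≤-refl)
    -- The edge o₁ is the outer edge of τ₁ glued with A as W_{1,0}.
    initial-measures o-first = sym (trans (len-AW 0 0 1≤N z≤n) (sdet-WW first))
    initial-measures (o-outer {i} {suc s} i<N _ s≤p) = sym (len-WW i s i<N s≤p)
    initial-measures (swap {u} {v} a) = trans (initial-measures a) (len-sym u v)

    -- Every reachable seed is measured by `len`, so the value does not depend on the flips used to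
    -- reach the arc.
    IsD⇒≈ : ∀ i {y} → suc i ≤ N → IsD (suc i) y → y ≈ ΔA (suc i)
    IsD⇒≈ i {y} i<N (S , mc , z , z∈ , y≈z) = begin
      y                                  ≈⟨ y≈z ⟩
      z                                  ≈⟨ mutation-measures initial-measures mc z∈ ⟩
      len A (W (suc i) (p (suc i) + 1))
        ≈⟨ subst (λ n → len A (W (suc i) n) ≈ sdet (side (suc i)) α (vW i n))
             (ℕ.+-comm 1 (p (suc i))) (len-AW i (p (suc i)) i<N ℕ.≤-refl) ⟩
      sdet (side (suc i)) α (vW i (p (suc i) + 1))
        ≡⟨ ΔA-suc i ⟨
      ΔA (suc i)                         ∎

    module _ (D : ℕ → Carrier) (D₀ : D 0 ≈ x[e 0 ])
             (isD : ∀ i → 1 ≤ i → i ≤ N → IsD i (D i)) where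

      D≈ΔA : ∀ i → i ≤ N → D i ≈ ΔA i
      D≈ΔA zero    _   = trans D₀ (sym det-αγ)
      D≈ΔA (suc i) i<N = IsD⇒≈ i i<N (isD (suc i) (s≤s z≤n) i<N)

      D-one : D 1 ≈ x[e 0 ] *ᶠ x[e p 1 + 1 ] *ᶠ ∑[ 1 ⋯ p 1 + 1 ] term
      D-one = trans (D≈ΔA 1 1≤N) ΔA-one

      D-recurrence : ∀ i → 2 ≤ i → i ≤ N → D i ≈
        (x[e P i + 1 ] / xe (P (i ∸ 1) + 1)) *ᶠ D (i ∸ 2)
          +ᶠ x[e P i + 1 ] *ᶠ (∑[ P (i ∸ 1) + 2 ⋯ P i + 1 ] term) *ᶠ D (i ∸ 1)
      D-recurrence (suc (suc i)) (s≤s (s≤s z≤n)) i+2≤N =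
        trans (D≈ΔA (suc (suc i)) i+2≤N) (trans (ΔA-recurrence i)
          (sym (+-cong (*-congˡ (D≈ΔA i (ℕ.<⇒≤ (ℕ.<⇒≤ i+2≤N)))) (*-congˡ (D≈ΔA (suc i) (ℕ.<⇒≤ i+2≤N))))))

theorem4p16 : ∀ {c ℓ₁ ℓ₂} (F : HeytingField c ℓ₁ ℓ₂) (N : ℕ) (p : ℕ → ℕ) →
  1 ≤ N →
  (∀ i → 1 ≤ i → i ≤ N → 1 ≤ p i) →
  (xe xo : ℕ → FieldNotation.Carrier* F) →
  let open FieldNotation F
      open Polygon p
      open Triangulation F N xe xo
  in
  (∀ i → 1 ≤ i → i ≤ N → ∃[ y ] IsD i y)
  ×
  ((D : ℕ → Carrier) → D 0 ≈ x[e 0 ] → (∀ i → 1 ≤ i → i ≤ N → IsD i (D i)) →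
    (N ≡ 1 →
      D 1 ≈ x[e 0 ] *ᶠ x[e p 1 + 1 ] *ᶠ ∑[ 1 ⋯ p 1 + 1 ] term)
    ×
    (2 ≤ N →
      D N ≈ (x[e P N + 1 ] / xe (P (N ∸ 1) + 1)) *ᶠ D (N ∸ 2)
            +ᶠ x[e P N + 1 ] *ᶠ (∑[ P (N ∸ 1) + 2 ⋯ P N + 1 ] term) *ᶠ D (N ∸ 1)))
theorem4p16 F N p 1≤N p≥1 xe xo =
  Existence.D-exists F N p p≥1 xe xo ,
  λ D D₀ isD →
    (λ _ → D-one 1≤N D D₀ isD) ,
    (λ 2≤N → D-recurrence 1≤N D D₀ isD N 2≤N ℕ.≤-refl)
  where open Coordinates F N p p≥1 xe xo
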